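{- For every positive integer $n$ and every function $\sigma\colon E(K_{4n})\to\{ -1,1\}$ with $\sigma(E(K_{4n}))=0$, there is a perfect matching $M$ in $K_{4n}$ with $\sigma(M)=0$.
   Context: $K_{4n}$ denotes the complete graph on $4n$ vertices. For a set $F$ of edges, $\sigma(F)=\sum_{e\in F}\sigma(e)$. -}

module Defs where

open import Data.Nat using (ℕ)
open import Data.Fin using (Fin; toℕ; _<_; _<?_)
open import Data.Fin.Properties using ()
open import Data.Integer using (ℤ; 0ℤ; _+_; +_; -[1+_])
open import Data.List using (List; allFin; map; filter; foldr; cartesianProduct)
open import Data.Product using (_×_; _,_; proj₁; proj₂)
open import Data.Sum using (_⊎_)
open import Relation.Binary.PropositionalEquality using (_≡_; _≢_)
open import Relation.Nullary using (¬_)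

sumℤ : List ℤ → ℤ
sumℤ = foldr _+_ 0ℤ

-- Vertices of K_m are Fin m.  Every unordered pair {i,j}, i ≠ j, is an edge;
-- we represent the edge {i,j} canonically by the ordered pair (i , j) with i < j.
-- An edge labelling of K_m is a function σ : Fin m → Fin m → ℤ, of which only
-- the values σ i j with i < j are meaningful (σ({i,j}) := σ i j for i < j).

edges : (m : ℕ) → List (Fin m × Fin m)
edges m = filter (λ p → proj₁ p <? proj₂ p) (cartesianProduct (allFin m) (allFin m))

IsSignLabelling : {m : ℕ} → (Fin m → Fin m → ℤ) → Set
IsSignLabelling {m} σ = ∀ (i j : Fin m) → i < j → (σ i j ≡ + 1) ⊎ (σ i j ≡ -[1+ 0 ])

σ-total : {m : ℕ} → (Fin m → Fin m → ℤ) → ℤ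
σ-total {m} σ = sumℤ (map (λ p → σ (proj₁ p) (proj₂ p)) (edges m))

-- A perfect matching of K_m, given by its partner function μ:
-- a fixed-point-free involution on the vertex set.  Its edge set is
-- { {i , μ i} : i ∈ Fin m }.
record PerfectMatching (m : ℕ) : Set where
  field
    partner     : Fin m → Fin m
    involutive  : ∀ i → partner (partner i) ≡ i
    fixpointFree : ∀ i → partner i ≢ i

matchingEdges : {m : ℕ} → PerfectMatching m → List (Fin m × Fin m)
matchingEdges {m} M =
  filter (λ p → proj₁ p <? proj₂ p)
         (map (λ i → i , PerfectMatching.partner M i) (allFin m))

σ-matching : {m : ℕ} → (Fin m → Fin m → ℤ) → PerfectMatching m → ℤ
σ-matching σ M = sumℤ (map (λ p → σ (proj₁ p) (proj₂ p)) (matchingEdges M))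

{-# OPTIONS --safe #-}
module Submission where

-- Colour the edges by sign and let the size of a perfect matching be its number of
-- negative edges; we look for size n.  Replacing two edges ab, cd of a matching by ac, bd
-- changes the size by at most 2.  If no exchange increases the size s of a matching, then
-- summing over all pairs of its edges bounds the number n(4n−1) of negative edges by
-- (4n−1)s, so s ≥ n.  Hence (up to swapping colours) either size n is reached or some
-- exchange jumps from size n−1 to n+1; then ab, cd are positive and ac, bd negative.
-- If size n never occurs, every exchange among the remaining edges preserves the parity of
-- the number of negative edges, and every other edge e is joined to {a,b,c,d} by an even
-- number of negative edges.  So the number of negative edges of K_{4n} has the parity of
-- n−1, whereas n(4n−1) has the parity of n.
--
-- A matching is handled as a list of pairs whose flattening permutes the vertex list.

open import Defs
open import Data.Bool using (Bool; true; false; not; if_then_else_)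
open import Data.Empty using (⊥; ⊥-elim)
open import Data.Fin as Fin using (Fin; _<?_)
open import Data.Fin.Properties as Fin using (_≟_)
open import Data.Integer as ℤ using (ℤ; 0ℤ; -[1+_]; _⊖_)
open import Data.List using (List; []; _∷_; _++_; map; length; filter; allFin; cartesianProduct)
open import Data.List.Membership.Propositional.Properties using (∈-allFin)
open import Data.List.Properties using (map-++; map-∘; map-cong; length-tabulate)
open import Data.List.Relation.Binary.Permutation.Propositional as ↭ using (_↭_; ↭-refl; ↭-sym; ↭-trans; ↭⇒↭ₛ; prep; swap)
open import Data.List.Relation.Binary.Permutation.Propositional.Properties using (↭-length; map⁺; ∈-resp-↭)
open import Data.List.Relation.Unary.All as All using (All; []; _∷_)
open import Data.List.Relation.Unary.All.Properties using (all-filter)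
open import Data.List.Relation.Unary.AllPairs using (AllPairs; []; _∷_)
open import Data.List.Relation.Unary.AllPairs.Properties using (tabulate⁺-<)
open import Data.List.Relation.Unary.Unique.Propositional using (Unique)
open import Data.List.Relation.Unary.Unique.Propositional.Properties using (allFin⁺)
import Data.Integer.Properties as ℤ
import Data.List.Relation.Binary.Permutation.Setoid.Properties as ↭ₛ
open import Data.Nat using (ℕ; zero; suc; _+_; _*_; _≤_; _<_; z≤n; s≤s)
open import Data.Nat.Divisibility using (_∣_; divides; ∣m∣n⇒∣m+n; ∣m+n∣m⇒∣n; m∣m*n; ∣-refl; _∣0)
open import Data.Nat.ListAction using (sum)
open import Data.Nat.ListAction.Properties using (sum-↭; sum-++)
open import Data.Nat.Properties using (≤-reflexive; ≤-trans; ≤-antisym; ≤-pred; <-≤-trans; <⇒≤; <⇒≱; ≮⇒≥; ≰⇒>; <-cmp; n≮n; suc-injective; even≢odd; m≤m+n; m≤n+m; m≤n⇒∃[o]m+o≡n; +-assoc; +-suc; +-identityʳ; +-mono-≤; +-monoˡ-≤; +-mono-<-≤; +-cancelˡ-≡; +-cancelʳ-≡; +-cancelʳ-≤; *-cancelˡ-≡; module ≤-Reasoning)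
open import Data.Nat.Tactic.RingSolver using (solve-∀)
open import Data.Product using (Σ; _×_; _,_; proj₁; proj₂)
open import Data.Sum using (inj₁; inj₂)
open import Data.Vec using (Vec; []; _∷_; lookup; tabulate)
open import Data.Vec.Properties using (lookup∘tabulate)
open import Relation.Binary.Definitions using (tri<; tri≈; tri>)
open import Relation.Binary.PropositionalEquality using (_≡_; _≢_; refl; sym; trans; cong; cong₂; subst; setoid; module ≡-Reasoning)
open import Relation.Nullary using (¬_; Dec; yes; no; does)
open import Relation.Nullary.Decidable using (decidable-stable; dec-true; dec-false; map′; _×-dec_; ¬?)
open import Relation.Nullary.Negation using (¬¬-map)
open import Relation.Unary using (Decidable)

-- Sums over lists, and flattenings of lists of pairs

∑ : ∀ {A : Set} → (A → ℕ) → List A → ℕ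
∑ f xs = sum (map f xs)

∑-↭ : ∀ {A : Set} (f : A → ℕ) {xs ys : List A} → xs ↭ ys → ∑ f xs ≡ ∑ f ys
∑-↭ f p = sum-↭ (map⁺ f p)

interchange : ∀ a b c d → (a + b) + (c + d) ≡ (a + c) + (b + d)
interchange = solve-∀

∑-+ : ∀ {A : Set} (f g : A → ℕ) xs → ∑ f xs + ∑ g xs ≡ ∑ (λ x → f x + g x) xs
∑-+ f g []       = refl
∑-+ f g (x ∷ xs) = trans (interchange (f x) (∑ f xs) (g x) (∑ g xs)) (cong ((f x + g x) +_) (∑-+ f g xs))

∑-even : ∀ {A : Set} {f : A → ℕ} {xs} → All (λ x → 2 ∣ f x) xs → 2 ∣ ∑ f xs
∑-even []       = 2 ∣0
∑-even (p ∷ ps) = ∣m∣n⇒∣m+n p (∑-even ps)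

-- Exchanges act on the head of a list, so a claim about each element is reduced to the case where
-- that element comes first.
All-↭∷ : ∀ {A : Set} {P : A → Set} xs → (∀ x ys → xs ↭ x ∷ ys → P x) → All P xs
All-↭∷ []       h = []
All-↭∷ (x ∷ xs) h =
  h x xs ↭-refl ∷ All-↭∷ xs (λ y ys p → h y (x ∷ ys) (↭-trans (prep x p) (swap x y ↭-refl)))

AllPairs-↭∷∷ : ∀ {A : Set} {R : A → A → Set} xs →
  (∀ x y zs → xs ↭ x ∷ y ∷ zs → R x y) → AllPairs R xs
AllPairs-↭∷∷ []       h = []
AllPairs-↭∷∷ (x ∷ xs) h =
  All-↭∷ xs (λ y ys p → h x y ys (prep x p)) ∷
  AllPairs-↭∷∷ xs (λ y z zs p → h y z (x ∷ zs)
    (↭-trans (prep x p) (↭-trans (swap x y ↭-refl) (prep y (swap x z ↭-refl)))))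

flatten : ∀ {V : Set} → List (V × V) → List V
flatten []            = []
flatten ((x , y) ∷ L) = x ∷ y ∷ flatten L

flatten-↭ : ∀ {V : Set} {L M : List (V × V)} → L ↭ M → flatten L ↭ flatten M
flatten-↭ ↭.refl = ↭-refl
flatten-↭ (↭.prep (x , y) p) = prep x (prep y (flatten-↭ p))
flatten-↭ {M = (c , d) ∷ (a , b) ∷ M} (↭.swap _ _ p) =
  ↭-trans (prep a (swap b c ↭-refl)) (↭-trans (swap a c ↭-refl)
    (prep c (↭-trans (prep a (swap b d ↭-refl)) (↭-trans (swap a d ↭-refl)
      (prep d (prep a (prep b (flatten-↭ p))))))))
flatten-↭ (↭.trans p q) = ↭-trans (flatten-↭ p) (flatten-↭ q)

length-flatten : ∀ {V : Set} (L : List (V × V)) → length (flatten L) ≡ 2 * length L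
length-flatten []      = refl
length-flatten (_ ∷ L) = trans (cong (λ k → suc (suc k)) (length-flatten L)) (sym (cong suc (+-suc (length L) _)))

-- Counting `true` edges inside and between the pairs of a list

⟦_⟧ : Bool → ℕ
⟦ false ⟧ = 0
⟦ true  ⟧ = 1

module Coloured {V : Set} (w : V → V → Bool) where

  # : V → V → ℕ
  # x y = ⟦ w x y ⟧

  weight : V × V → ℕ
  weight (x , y) = # x y

  size : List (V × V) → ℕ
  size = ∑ weight

  total : List V → ℕ
  total []       = 0
  total (x ∷ xs) = ∑ (# x) xs + total xs

  -- The four edges between two pairs, grouped into the two possible exchanges ac, bd and ad, bc.
  cross : V × V → V × V → ℕ
  cross (a , b) (c , d) = (# a c + # b d) + (# a d + # b c)

  crossings : List (V × V) → ℕ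
  crossings []      = 0
  crossings (e ∷ L) = ∑ (cross e) L + crossings L

  ∑-cross : ∀ a b L → ∑ (# a) (flatten L) + ∑ (# b) (flatten L) ≡ ∑ (cross (a , b)) L
  ∑-cross a b []            = refl
  ∑-cross a b ((c , d) ∷ L) =
    trans (arith (# a c) (# a d) (# b c) (# b d) (∑ (# a) (flatten L)) (∑ (# b) (flatten L)))
          (cong (cross (a , b) (c , d) +_) (∑-cross a b L))
    where
    arith : ∀ p q r s S T → (p + (q + S)) + (r + (s + T)) ≡ ((p + s) + (q + r)) + (S + T)
    arith = solve-∀

  -- Every edge on the vertices of `L` either is a pair of `L` or joins two different pairs.
  total-flatten : ∀ L → total (flatten L) ≡ size L + crossings L
  total-flatten []            = refl
  total-flatten ((a , b) ∷ L) = begin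
      (# a b + ∑ (# a) (flatten L)) + (∑ (# b) (flatten L) + total (flatten L))
    ≡⟨ arith (# a b) (∑ (# a) (flatten L)) (∑ (# b) (flatten L)) (total (flatten L)) ⟩
      # a b + ((∑ (# a) (flatten L) + ∑ (# b) (flatten L)) + total (flatten L))
    ≡⟨ cong (# a b +_) (cong₂ _+_ (∑-cross a b L) (total-flatten L)) ⟩
      # a b + (∑ (cross (a , b)) L + (size L + crossings L))
    ≡⟨ arith′ (# a b) (∑ (cross (a , b)) L) (size L) (crossings L) ⟩
      (# a b + size L) + (∑ (cross (a , b)) L + crossings L) ∎
    where
    open ≡-Reasoning
    arith : ∀ p S T t → (p + S) + (T + t) ≡ p + ((S + T) + t)
    arith = solve-∀
    arith′ : ∀ p S s t → p + (S + (s + t)) ≡ (p + s) + (S + t)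
    arith′ = solve-∀

  crossings-even : ∀ {L} → AllPairs (λ e f → 2 ∣ cross e f) L → 2 ∣ crossings L
  crossings-even []       = 2 ∣0
  crossings-even (p ∷ ps) = ∣m∣n⇒∣m+n (∑-even p) (crossings-even ps)

  ∑-cross-≤ : ∀ e {L} → All (λ f → cross e f ≤ 2 * (weight e + weight f)) L →
    ∑ (cross e) L ≤ 2 * (length L * weight e + size L)
  ∑-cross-≤ e []                  = z≤n
  ∑-cross-≤ e {f ∷ L} (p ∷ ps) = ≤-trans (+-mono-≤ p (∑-cross-≤ e ps))
    (≤-reflexive (arith (weight e) (weight f) (length L) (size L)))
    where
    arith : ∀ e f l s → 2 * (e + f) + 2 * (l * e + s) ≡ 2 * (suc l * e + (f + s))
    arith = solve-∀

  -- In the sum over all pairs of edges each weight occurs `length L` minus one times, doubled; the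
  -- term `2 * size L` on the left replaces that subtraction.
  crossings-≤ : ∀ {L} → AllPairs (λ e f → cross e f ≤ 2 * (weight e + weight f)) L →
    crossings L + 2 * size L ≤ 2 * length L * size L
  crossings-≤ []                = z≤n
  crossings-≤ {e ∷ L} (p ∷ ps) = begin
      (∑ (cross e) L + crossings L) + 2 * (weight e + size L)
    ≡⟨ arith (∑ (cross e) L) (crossings L) (weight e) (size L) ⟩
      ∑ (cross e) L + ((crossings L + 2 * size L) + 2 * weight e)
    ≤⟨ +-mono-≤ (∑-cross-≤ e p) (+-monoˡ-≤ (2 * weight e) (crossings-≤ ps)) ⟩
      2 * (length L * weight e + size L) + (2 * length L * size L + 2 * weight e)
    ≡⟨ arith′ (length L) (weight e) (size L) ⟩
      2 * suc (length L) * (weight e + size L) ∎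
    where
    open ≤-Reasoning
    arith : ∀ S c w s → (S + c) + 2 * (w + s) ≡ S + ((c + 2 * s) + 2 * w)
    arith = solve-∀
    arith′ : ∀ l w s → 2 * (l * w + s) + (2 * l * s + 2 * w) ≡ 2 * suc l * (w + s)
    arith′ = solve-∀

  module _ (w-sym : ∀ x y → w x y ≡ w y x) where

    #-sym : ∀ x y → # x y ≡ # y x
    #-sym x y = cong ⟦_⟧ (w-sym x y)

    -- Only a transposition reverses an edge, and the symmetry of `w` absorbs the reversal.
    total-↭ : ∀ {xs ys} → xs ↭ ys → total xs ≡ total ys
    total-↭ ↭.refl       = refl
    total-↭ (↭.prep x p) = cong₂ _+_ (∑-↭ (# x) p) (total-↭ p)
    total-↭ {_ ∷ _ ∷ xs} {_ ∷ _ ∷ ys} (↭.swap x y p)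
      rewrite #-sym x y | ∑-↭ (# x) p | ∑-↭ (# y) p | total-↭ p =
      arith (# y x) (∑ (# x) ys) (∑ (# y) ys) (total ys)
      where
      arith : ∀ p S T t → (p + S) + (T + t) ≡ (p + T) + (S + t)
      arith = solve-∀
    total-↭ (↭.trans p q) = trans (total-↭ p) (total-↭ q)

-- Arithmetic of a single exchange

-- Two new edges raise the size by at most two, so passing over n means going from n - 1 to n + 1,
-- and this determines all four colours.
crossing-values : ∀ p q r s {k n} →
  ⟦ p ⟧ + (⟦ q ⟧ + k) < n → n < ⟦ r ⟧ + (⟦ s ⟧ + k) →
  p ≡ false × q ≡ false × r ≡ true × s ≡ true × n ≡ suc k
crossing-values p q false false {k} lo hi =
  ⊥-elim (<⇒≱ hi (≤-trans (≤-trans (m≤n+m k ⟦ q ⟧) (m≤n+m (⟦ q ⟧ + k) ⟦ p ⟧)) (<⇒≤ lo)))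
crossing-values p q false true {k} lo hi =
  ⊥-elim (<⇒≱ hi (≤-trans (s≤s (≤-trans (m≤n+m k ⟦ q ⟧) (m≤n+m (⟦ q ⟧ + k) ⟦ p ⟧))) lo))
crossing-values p q true false {k} lo hi =
  ⊥-elim (<⇒≱ hi (≤-trans (s≤s (≤-trans (m≤n+m k ⟦ q ⟧) (m≤n+m (⟦ q ⟧ + k) ⟦ p ⟧))) lo))
crossing-values false false true true lo hi = refl , refl , refl , refl , ≤-antisym (≤-pred hi) lo
crossing-values false true true true lo hi = ⊥-elim (<⇒≱ hi lo)
crossing-values true false true true lo hi = ⊥-elim (<⇒≱ hi lo)
crossing-values true true true true lo hi = ⊥-elim (<⇒≱ hi (<⇒≤ lo))

-- The two colours sum to 0, 1 or 2, and the hypothesis excludes exactly 1.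
equal-even : ∀ p q {k} → ⟦ p ⟧ + (⟦ q ⟧ + k) ≢ suc k → 2 ∣ (⟦ p ⟧ + ⟦ q ⟧)
equal-even false false _ = 2 ∣0
equal-even false true  h = ⊥-elim (h refl)
equal-even true  false h = ⊥-elim (h refl)
equal-even true  true  _ = ∣-refl

-- Sums between 0 and 2 of different parity differ by exactly 1; the hypotheses exclude one
-- direction each.
same-parity : ∀ p q r s {k} →
  ⟦ p ⟧ + (⟦ q ⟧ + k) ≢ suc (⟦ r ⟧ + (⟦ s ⟧ + k)) →
  suc (⟦ p ⟧ + (⟦ q ⟧ + k)) ≢ ⟦ r ⟧ + (⟦ s ⟧ + k) →
  2 ∣ ((⟦ p ⟧ + ⟦ q ⟧) + (⟦ r ⟧ + ⟦ s ⟧))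
same-parity p q false false h _ = subst (2 ∣_) (sym (+-identityʳ _)) (equal-even p q h)
same-parity p q true true _ h =
  ∣m∣n⇒∣m+n (equal-even p q (λ e → h (cong suc e))) ∣-refl
same-parity false true  false true  _ _ = ∣-refl
same-parity false true  true  false _ _ = ∣-refl
same-parity true  false false true  _ _ = ∣-refl
same-parity true  false true  false _ _ = ∣-refl
same-parity false false false true  _ h = ⊥-elim (h refl)
same-parity false false true  false _ h = ⊥-elim (h refl)
same-parity true  true  false true  h _ = ⊥-elim (h refl)
same-parity true  true  true  false h _ = ⊥-elim (h refl)

-- Exchanges when no perfect matching has size n

module Matchings {V : Set} (w : V → V → Bool) (w-sym : ∀ x y → w x y ≡ w y x)
  (vs : List V) (n : ℕ)
  (length-vs : length vs ≡ 4 * n)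
  -- The number of `true` edges is n(4n - 1), half of all edges; n is moved across to avoid
  -- subtraction.
  (balanced : Coloured.total w vs + n ≡ 4 * n * n)
  (unbalanced : ∀ L → flatten L ↭ vs → Coloured.size w L ≢ n)
  where

  open Coloured w

  Matching : List (V × V) → Set
  Matching L = flatten L ↭ vs

  swap₁ : ∀ {a b c d L} → Matching ((a , b) ∷ (c , d) ∷ L) → Matching ((a , c) ∷ (b , d) ∷ L)
  swap₁ m = ↭-trans (prep _ (swap _ _ ↭-refl)) m

  flip₂ : ∀ {e c d L} → Matching (e ∷ (c , d) ∷ L) → Matching (e ∷ (d , c) ∷ L)
  flip₂ m = ↭-trans (prep _ (prep _ (swap _ _ ↭-refl))) m

  swap₂ : ∀ {a b c d L} → Matching ((a , b) ∷ (c , d) ∷ L) → Matching ((a , d) ∷ (b , c) ∷ L)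
  swap₂ m = swap₁ (flip₂ m)

  reorder : ∀ {L M} → L ↭ M → Matching L → Matching M
  reorder p m = ↭-trans (flatten-↭ (↭-sym p)) m

  total-matching : ∀ {L} → Matching L → total vs ≡ size L + crossings L
  total-matching {L} m = trans (sym (total-↭ w-sym m)) (total-flatten L)

  length-matching : ∀ {L} → Matching L → 2 * length L ≡ 4 * n
  length-matching {L} m = trans (sym (length-flatten L)) (trans (↭-length m) length-vs)

  -- Parity contradiction from an exchange that jumps over size n

  module Crossing {a b c d R} (m : Matching ((a , b) ∷ (c , d) ∷ R))
    (ab : w a b ≡ false) (cd : w c d ≡ false) (ac : w a c ≡ true) (bd : w b d ≡ true)
    (n≡ : n ≡ suc (size R)) where

    M : List (V × V)
    M = (a , b) ∷ (c , d) ∷ R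

    size-M : ∀ L → size ((a , b) ∷ (c , d) ∷ L) ≡ size L
    size-M L rewrite ab | cd = refl

    size-M′ : ∀ L → size ((a , c) ∷ (b , d) ∷ L) ≡ suc (suc (size L))
    size-M′ L rewrite ac | bd = refl

    -- `M` has size n - 1 and its exchange has size n + 1, so a change elsewhere by +1 in the first
    -- or by -1 in the second would give size n. `change` leaves the two front edges arbitrary so
    -- that it applies to both matchings.
    alternative : ∀ {e f Q} → R ↭ e ∷ f ∷ Q → ∀ x y u v →
      (∀ {g h} → Matching (g ∷ h ∷ e ∷ f ∷ Q) → Matching (g ∷ h ∷ (x , y) ∷ (u , v) ∷ Q)) →
      2 ∣ ((# x y + # u v) + (weight e + weight f))
    alternative {e@(e₁ , e₂)} {f@(f₁ , f₂)} {Q} p x y u v change =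
      same-parity (w x y) (w u v) (w e₁ e₂) (w f₁ f₂) {size Q}
      (λ eq → unbalanced _ (change (reorder (prep _ (prep _ p)) m))
        (trans (size-M ((x , y) ∷ (u , v) ∷ Q)) (trans eq (sym n≡′))))
      (λ eq → unbalanced _ (change (reorder (prep _ (prep _ p)) (swap₁ m)))
        (trans (size-M′ ((x , y) ∷ (u , v) ∷ Q)) (trans (cong suc eq) (sym n≡′))))
      where
      n≡′ : n ≡ suc (weight e + (weight f + size Q))
      n≡′ = trans n≡ (cong suc (∑-↭ weight p))

    -- Each of the two exchanges of `e` with `f` keeps the parity of s, the sum of their weights;
    -- adding both statements leaves the cross count plus 2s.
    inner-even : ∀ e f Q → R ↭ e ∷ f ∷ Q → 2 ∣ cross e f
    inner-even (x , y) (u , v) Q p = ∣m+n∣m⇒∣n {m = 2 * s}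
      (subst (2 ∣_) (arith (# x u + # y v) (# x v + # y u) s)
        (∣m∣n⇒∣m+n (alternative p x u y v (inner swap₁)) (alternative p x v y u (inner swap₂))))
      (m∣m*n s)
      where
      s = # x y + # u v
      arith : ∀ p q s → (p + s) + (q + s) ≡ 2 * s + (p + q)
      arith = solve-∀
      front : ∀ {g h e f : V × V} {L} → g ∷ h ∷ e ∷ f ∷ L ↭ e ∷ f ∷ g ∷ h ∷ L
      front = ↭-trans (prep _ (swap _ _ ↭-refl)) (↭-trans (swap _ _ ↭-refl)
                (prep _ (↭-trans (prep _ (swap _ _ ↭-refl)) (swap _ _ ↭-refl))))
      inner : ∀ {e f e′ f′} → (∀ {L} → Matching (e ∷ f ∷ L) → Matching (e′ ∷ f′ ∷ L)) →
        ∀ {g h L} → Matching (g ∷ h ∷ e ∷ f ∷ L) → Matching (g ∷ h ∷ e′ ∷ f′ ∷ L)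
      inner change m = reorder front (change (reorder front m))

    -- Next to `f` and `Q`, two further edges give size n exactly when they contribute 1, so either
    -- exchange of `(p , q)` with `(x , y)` contributes 0 or 2.
    same-colour : ∀ {p q x y f Q} → Matching ((p , q) ∷ (x , y) ∷ f ∷ Q) →
      n ≡ weight f + suc (size Q) → 2 ∣ cross (p , q) (x , y)
    same-colour {p} {q} {x} {y} {f} {Q} m n≡ = ∣m∣n⇒∣m+n
      (equal-even (w p x) (w q y) (λ eq → unbalanced _ (swap₁ m) (finish (# p x) (# q y) eq)))
      (equal-even (w p y) (w q x) (λ eq → unbalanced _ (swap₂ m) (finish (# p y) (# q x) eq)))
      where
      arith : ∀ s t f k → s + (t + (f + k)) ≡ f + (s + (t + k))
      arith = solve-∀
      finish : ∀ s t → s + (t + size Q) ≡ suc (size Q) → s + (t + (weight f + size Q)) ≡ n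
      finish s t eq = trans (arith s t (weight f) (size Q)) (trans (cong (weight f +_) eq) (sym n≡))

    outer-even : ∀ e Q → R ↭ e ∷ Q → 2 ∣ (cross (a , b) e + cross (c , d) e)
    outer-even e@(x , y) Q p = by-colour (w x y) refl
      where
      n≡′ : n ≡ suc (# x y + size Q)
      n≡′ = trans n≡ (cong suc (∑-↭ weight p))
      rot : ∀ {g h : V × V} {L} → g ∷ h ∷ e ∷ L ↭ g ∷ e ∷ h ∷ L
      rot = prep _ (swap _ _ ↭-refl)
      rot′ : ∀ {g h : V × V} {L} → g ∷ h ∷ e ∷ L ↭ h ∷ e ∷ g ∷ L
      rot′ = ↭-trans (swap _ _ ↭-refl) (prep _ (swap _ _ ↭-refl))
      -- Both sides count the edges from {x, y} to {a, b, c, d}, with the four vertices paired as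
      -- ac, bd or as ab, cd.
      regroup : ∀ ax ay bx by cx cy dx dy →
        ((ax + cy) + (ay + cx)) + ((bx + dy) + (by + dx)) ≡
        ((ax + by) + (ay + bx)) + ((cx + dy) + (cy + dx))
      regroup = solve-∀
      -- Use the matching among M and its exchange (a , c) , (b , d) in which the
      -- two edges on {a , b , c , d} have the colour of e.
      by-colour : ∀ xy → w x y ≡ xy → 2 ∣ (cross (a , b) e + cross (c , d) e)
      by-colour false xy = ∣m∣n⇒∣m+n
        (same-colour (reorder (↭-trans (prep _ (prep _ p)) rot) m) (trans n≡″ (cong (λ z → ⟦ z ⟧ + suc (size Q)) (sym cd))))
        (same-colour (reorder (↭-trans (prep _ (prep _ p)) rot′) m) (trans n≡″ (cong (λ z → ⟦ z ⟧ + suc (size Q)) (sym ab))))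
        where
        n≡″ : n ≡ suc (size Q)
        n≡″ = trans n≡′ (cong (λ z → suc (⟦ z ⟧ + size Q)) xy)
      by-colour true xy = subst (2 ∣_)
        (regroup (# a x) (# a y) (# b x) (# b y) (# c x) (# c y) (# d x) (# d y))
        (∣m∣n⇒∣m+n
          (same-colour (reorder (↭-trans (prep _ (prep _ p)) rot) (swap₁ m)) (trans n≡″ (cong (λ z → ⟦ z ⟧ + suc (size Q)) (sym bd))))
          (same-colour (reorder (↭-trans (prep _ (prep _ p)) rot′) (swap₁ m)) (trans n≡″ (cong (λ z → ⟦ z ⟧ + suc (size Q)) (sym ac)))))
        where
        n≡″ : n ≡ suc (suc (size Q))
        n≡″ = trans n≡′ (cong (λ z → suc (⟦ z ⟧ + size Q)) xy)

    -- The edges ac and bd contribute 2; a contribution of 1 from ad and bc would turn that exchange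
    -- into a matching of size n.
    quad-even : 2 ∣ cross (a , b) (c , d)
    quad-even = ∣m∣n⇒∣m+n
      (subst (2 ∣_) (cong₂ (λ s t → ⟦ s ⟧ + ⟦ t ⟧) (sym ac) (sym bd)) ∣-refl)
      (equal-even (w a d) (w b c) (λ eq → unbalanced _ (swap₂ m) (trans eq (sym n≡))))

    -- Pairs of edges of `M` are of three kinds: ab with cd, either of these with an edge of `R`,
    -- and two edges of `R`. In the second kind ab and cd are taken together.
    M-even : 2 ∣ crossings M
    M-even = subst (2 ∣_)
      (trans (cong (λ z → cross (a , b) (c , d) + (z + crossings R))
                   (sym (∑-+ (cross (a , b)) (cross (c , d)) R)))
             (arith (cross (a , b) (c , d)) (∑ (cross (a , b)) R) (∑ (cross (c , d)) R) (crossings R)))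
      (∣m∣n⇒∣m+n quad-even
        (∣m∣n⇒∣m+n (∑-even (All-↭∷ R outer-even)) (crossings-even (AllPairs-↭∷∷ R inner-even))))
      where
      arith : ∀ p S T t → p + ((S + T) + t) ≡ (p + S) + (T + t)
      arith = solve-∀

    -- By `balanced` the total plus n is the even number 4n², but counted along `M` it is (n - 1)
    -- plus an even number plus n.
    absurd : ⊥
    absurd with M-even
    ... | divides q eq = even≢odd (2 * n * n) (q + size R) (begin
        2 * (2 * n * n)                        ≡⟨ arith n ⟩
        4 * n * n                              ≡⟨ balanced ⟨
        total vs + n                           ≡⟨ cong₂ _+_ (total-matching m) n≡ ⟩
        (size M + crossings M) + suc (size R)  ≡⟨ cong₂ (λ s t → (s + t) + suc (size R)) (size-M R) eq ⟩
        (size R + q * 2) + suc (size R)        ≡⟨ arith′ (size R) q ⟩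
        suc (2 * (q + size R))                 ∎)
      where
      open ≡-Reasoning
      arith : ∀ n → 2 * (2 * n * n) ≡ 4 * n * n
      arith = solve-∀
      arith′ : ∀ k q → (k + q * 2) + suc k ≡ suc (2 * (q + k))
      arith′ = solve-∀

  -- Averaging over exchanges that do not increase the size

  no-crossing : ∀ {a b c d R} → Matching ((a , b) ∷ (c , d) ∷ R) →
    size ((a , b) ∷ (c , d) ∷ R) < n → ¬ n < size ((a , c) ∷ (b , d) ∷ R)
  no-crossing {a} {b} {c} {d} m lo hi with crossing-values (w a b) (w c d) (w a c) (w b d) lo hi
  ... | ab , cd , ac , bd , n≡ = Crossing.absurd m ab cd ac bd n≡

  -- Induction on a bound for n − size L: an exchange raising the size contradicts the
  -- induction hypothesis, balances the matching, or is a crossing.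
  not-small : ∀ fuel L → Matching L → n ≤ size L + fuel → ¬ size L < n
  not-small zero L m close small = <⇒≱ small (subst (n ≤_) (+-identityʳ _) close)
  not-small (suc fuel) L m close small = <⇒≱ (above-average small) average
    where
    exchange-≤ : ∀ {a b c d R} → Matching ((a , b) ∷ (c , d) ∷ R) →
      size L ≡ size ((a , b) ∷ (c , d) ∷ R) → # a c + # b d ≤ # a b + # c d
    exchange-≤ {a} {b} {c} {d} {R} m size-L = +-cancelʳ-≤ (size R) _ _ (begin
        (# a c + # b d) + size R  ≡⟨ +-assoc (# a c) _ _ ⟩
        size L′                   ≤⟨ ≮⇒≥ no-increase ⟩
        size L                    ≡⟨ size-L ⟩
        # a b + (# c d + size R)  ≡⟨ +-assoc (# a b) _ _ ⟨
        (# a b + # c d) + size R  ∎)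
      where
      open ≤-Reasoning
      L′ = (a , c) ∷ (b , d) ∷ R
      no-increase : ¬ size L < size L′
      no-increase inc with <-cmp (size L′) n
      ... | tri< lt _ _ = not-small fuel L′ (swap₁ m)
        (≤-trans close (≤-trans (≤-reflexive (+-suc (size L) fuel)) (+-monoˡ-≤ fuel inc))) lt
      ... | tri≈ _ eq _ = unbalanced L′ (swap₁ m) eq
      ... | tri> _ _ gt = no-crossing m (subst (_< n) size-L small) gt

    -- Neither exchange of `e` with `f` outweighs the two edges; reversing `(c , d)` brings the
    -- second exchange to the form of the first.
    cross-≤ : ∀ e f R → L ↭ e ∷ f ∷ R → cross e f ≤ 2 * (weight e + weight f)
    cross-≤ (a , b) (c , d) R p = begin
        (# a c + # b d) + (# a d + # b c)
      ≤⟨ +-mono-≤ (exchange-≤ m₀ size-L) (exchange-≤ (flip₂ m₀) size-L-flipped) ⟩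
        (# a b + # c d) + (# a b + # d c)
      ≡⟨ cong (λ z → (# a b + # c d) + (# a b + z)) (#-sym w-sym d c) ⟩
        (# a b + # c d) + (# a b + # c d)
      ≡⟨ cong ((# a b + # c d) +_) (+-identityʳ _) ⟨
        2 * (# a b + # c d) ∎
      where
      open ≤-Reasoning
      m₀ = reorder p m
      size-L : size L ≡ # a b + (# c d + size R)
      size-L = ∑-↭ weight p
      size-L-flipped : size L ≡ # a b + (# d c + size R)
      size-L-flipped = trans size-L (cong (λ z → # a b + (z + size R)) (#-sym w-sym c d))

    -- This is n(4n - 1) ≤ (4n - 1) · `size L` with the subtractions moved across: the bound on all
    -- crossings, compared with the number of `true` edges.
    average : 4 * n * n + size L ≤ 4 * n * size L + n
    average = begin
        4 * n * n + size L                      ≡⟨ cong (_+ size L) balanced ⟨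
        (total vs + n) + size L                 ≡⟨ cong (λ t → (t + n) + size L) (total-matching m) ⟩
        ((size L + crossings L) + n) + size L   ≡⟨ arith (size L) (crossings L) n ⟩
        (crossings L + 2 * size L) + n          ≤⟨ +-monoˡ-≤ n (crossings-≤ (AllPairs-↭∷∷ L cross-≤)) ⟩
        2 * length L * size L + n               ≡⟨ cong (λ l → l * size L + n) (length-matching m) ⟩
        4 * n * size L + n                      ∎
      where
      open ≤-Reasoning
      arith : ∀ s c n → ((s + c) + n) + s ≡ (c + 2 * s) + n
      arith = solve-∀

    above-average : ∀ {s n} → s < n → 4 * n * s + n < 4 * n * n + s
    above-average {s} s<n with m≤n⇒∃[o]m+o≡n s<n
    -- Here n = s + o + 1, and the gap is (4n - 1)(o + 1) with 4n - 1 = 3 + 4(s + o). The added term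
    -- is the gap minus 1, as the inequality is strict.
    ... | o , refl = ≤-trans (m≤m+n _ _) (≤-reflexive (arith s o))
      where
      arith : ∀ s o → suc (4 * suc (s + o) * s + suc (s + o)) + (2 + 4 * (s + o) + o * (3 + 4 * (s + o)))
                      ≡ 4 * suc (s + o) * suc (s + o) + s
      arith = solve-∀

-- The complementary colouring

complement : ∀ {V : Set} → (V → V → Bool) → V → V → Bool
complement w x y = not (w x y)

⟦⟧-complement : ∀ b → ⟦ b ⟧ + ⟦ not b ⟧ ≡ 1
⟦⟧-complement false = refl
⟦⟧-complement true  = refl

∑-complement : ∀ {A : Set} (p : A → Bool) xs →
  ∑ (λ x → ⟦ p x ⟧) xs + ∑ (λ x → ⟦ not (p x) ⟧) xs ≡ length xs
∑-complement p []       = refl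
∑-complement p (x ∷ xs) =
  trans (interchange ⟦ p x ⟧ _ ⟦ not (p x) ⟧ _) (cong₂ _+_ (⟦⟧-complement (p x)) (∑-complement p xs))

module _ {V : Set} (w : V → V → Bool) where

  open Coloured

  size-complement : ∀ L → size w L + size (complement w) L ≡ length L
  size-complement = ∑-complement (λ e → w (proj₁ e) (proj₂ e))

  -- Each of the l(l - 1)/2 pairs of positions is counted in exactly one of the two totals; doubling
  -- and adding l avoids division and subtraction.
  total-complement : ∀ xs →
    2 * (total w xs + total (complement w) xs) + length xs ≡ length xs * length xs
  total-complement []       = refl
  total-complement (x ∷ xs) = begin
      2 * ((S + T) + (S′ + T′)) + suc l
    ≡⟨ cong (λ z → 2 * z + suc l) (interchange S T S′ T′) ⟩
      2 * ((S + S′) + (T + T′)) + suc l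
    ≡⟨ cong (λ z → 2 * (z + (T + T′)) + suc l) (∑-complement (w x) xs) ⟩
      2 * (l + (T + T′)) + suc l
    ≡⟨ arith l (T + T′) ⟩
      (2 * (T + T′) + l) + suc (2 * l)
    ≡⟨ cong (_+ suc (2 * l)) (total-complement xs) ⟩
      l * l + suc (2 * l)
    ≡⟨ arith′ l ⟩
      suc l * suc l ∎
    where
    open ≡-Reasoning
    l = length xs
    S = ∑ (# w x) xs
    S′ = ∑ (# (complement w) x) xs
    T = total w xs
    T′ = total (complement w) xs
    arith : ∀ l t → 2 * (l + t) + suc l ≡ (2 * t + l) + suc (2 * l)
    arith = solve-∀
    arith′ : ∀ l → l * l + suc (2 * l) ≡ suc l * suc l
    arith′ = solve-∀

-- Existence of a matching of size n, up to double negation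

pair-up : ∀ {V : Set} k (xs : List V) → length xs ≡ 2 * k → Σ (List (V × V)) (λ L → flatten L ≡ xs)
pair-up zero    []           _  = [] , refl
pair-up (suc k) (x ∷ [])     eq with trans (suc-injective eq) (+-suc k _)
... | ()
pair-up (suc k) (x ∷ y ∷ xs) eq
  with pair-up k xs (suc-injective (trans (suc-injective eq) (+-suc k _)))
... | L , refl = (x , y) ∷ L , refl

module _ {V : Set} (w : V → V → Bool) (w-sym : ∀ x y → w x y ≡ w y x)
  (vs : List V) (n : ℕ) (length-vs : length vs ≡ 4 * n)
  (equal-totals : Coloured.total w vs ≡ Coloured.total (complement w) vs) where

  open Coloured

  total-vs : total w vs + n ≡ 4 * n * n
  total-vs = *-cancelˡ-≡ _ _ 4 (begin
      4 * (total w vs + n)                                        ≡⟨ arith (total w vs) n ⟩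
      2 * (total w vs + total w vs) + 4 * n                       ≡⟨ cong₂ (λ t l → 2 * (total w vs + t) + l) equal-totals (sym length-vs) ⟩
      2 * (total w vs + total (complement w) vs) + length vs      ≡⟨ total-complement w vs ⟩
      length vs * length vs                                       ≡⟨ cong₂ _*_ length-vs length-vs ⟩
      4 * n * (4 * n)                                             ≡⟨ arith′ n ⟩
      4 * (4 * n * n)                                             ∎)
    where
    open ≡-Reasoning
    arith : ∀ t n → 4 * (t + n) ≡ 2 * (t + t) + 4 * n
    arith = solve-∀
    arith′ : ∀ n → 4 * n * (4 * n) ≡ 4 * (4 * n * n)
    arith′ = solve-∀

  size-sum : ∀ L → flatten L ↭ vs → size w L + size (complement w) L ≡ n + n
  size-sum L m = trans (size-complement w L) (*-cancelˡ-≡ _ _ 2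
    (trans (sym (length-flatten L)) (trans (↭-length m) (trans length-vs (arith n)))))
    where
    arith : ∀ n → 4 * n ≡ 2 * (n + n)
    arith = solve-∀

  -- The exchange argument starts from the absence of a matching of size n, hence the double
  -- negation. As the sizes in the two colours sum to 2n, a starting matching above n in one colour
  -- is below n in the other.
  balanced-matching : ¬ ¬ Σ (List (V × V)) (λ L → flatten L ↭ vs × size w L ≡ n)
  balanced-matching none with pair-up (2 * n) vs (trans length-vs (arith n))
    where
    arith : ∀ n → 4 * n ≡ 2 * (2 * n)
    arith = solve-∀
  ... | L , refl with <-cmp (size w L) n
  -- Fuel n is enough for every size, since n is at most the size plus n.
  ... | tri< lt _ _ = Matchings.not-small w w-sym vs n length-vs total-vs
    (λ L m eq → none (L , m , eq)) n L ↭-refl (m≤n+m n _) lt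
  ... | tri≈ _ eq _ = none (L , ↭-refl , eq)
  ... | tri> _ _ gt = Matchings.not-small (complement w) (λ x y → cong not (w-sym x y)) vs n length-vs
    (trans (cong (_+ n) (sym equal-totals)) total-vs)
    (λ L m eq → none (L , m , +-cancelʳ-≡ n _ _ (trans (cong (size w L +_) (sym eq)) (size-sum L m))))
    n L ↭-refl (m≤n+m n _) (≰⇒> (λ le → n≮n _ (<-≤-trans (+-mono-<-≤ gt le) (≤-reflexive (size-sum L ↭-refl)))))

-- Further facts on flattenings, filters and products

All-flatten⁻ : ∀ {V : Set} {P : V → Set} L → All P (flatten L) → All (λ e → P (proj₁ e) × P (proj₂ e)) L
All-flatten⁻ []      []           = []
All-flatten⁻ (_ ∷ L) (p ∷ q ∷ ps) = (p , q) ∷ All-flatten⁻ L ps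

All-flatten⁺ : ∀ {V : Set} {P : V → Set} {L} → All (λ e → P (proj₁ e) × P (proj₂ e)) L → All P (flatten L)
All-flatten⁺ []             = []
All-flatten⁺ ((p , q) ∷ ps) = p ∷ q ∷ All-flatten⁺ ps

∑-filter : ∀ {A : Set} {P : A → Set} (P? : Decidable P) (f : A → ℕ) xs →
  ∑ f (filter P? xs) ≡ ∑ (λ x → if does (P? x) then f x else 0) xs
∑-filter P? f []       = refl
∑-filter P? f (x ∷ xs) with does (P? x)
... | false = ∑-filter P? f xs
... | true  = cong (f x +_) (∑-filter P? f xs)

∑-++ : ∀ {A : Set} (f : A → ℕ) xs ys → ∑ f (xs ++ ys) ≡ ∑ f xs + ∑ f ys
∑-++ f xs ys = trans (cong sum (map-++ f xs ys)) (sum-++ (map f xs) (map f ys))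

∑-map : ∀ {A B : Set} (f : B → ℕ) (g : A → B) xs → ∑ f (map g xs) ≡ ∑ (λ x → f (g x)) xs
∑-map f g xs = cong sum (sym (map-∘ xs))

∑-cong : ∀ {A : Set} {f g : A → ℕ} {xs} → All (λ x → f x ≡ g x) xs → ∑ f xs ≡ ∑ g xs
∑-cong []       = refl
∑-cong (p ∷ ps) = cong₂ _+_ p (∑-cong ps)

∑-zero : ∀ {A : Set} (xs : List A) → ∑ (λ _ → 0) xs ≡ 0
∑-zero []       = refl
∑-zero (_ ∷ xs) = ∑-zero xs

∑-cartesianProduct : ∀ {A B : Set} (f : A × B → ℕ) xs ys →
  ∑ f (cartesianProduct xs ys) ≡ ∑ (λ x → ∑ (λ y → f (x , y)) ys) xs
∑-cartesianProduct f []       ys = refl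
∑-cartesianProduct f (x ∷ xs) ys = trans (∑-++ f (map (x ,_) ys) _)
  (cong₂ _+_ (∑-map f (x ,_) ys) (∑-cartesianProduct f xs ys))

-- Edges and perfect matchings of the complete graph on `Fin m`

module _ {m : ℕ} where

  Ascending : Fin m × Fin m → Set
  Ascending e = proj₁ e Fin.< proj₂ e

  ascending? : Decidable Ascending
  ascending? e = proj₁ e <? proj₂ e

  module _ (w : Fin m → Fin m → Bool) where

    open Coloured w

    -- Moves the filter on ascending pairs into the summand, so that sums can run over all ordered
    -- pairs.
    weight< : Fin m → Fin m → ℕ
    weight< i j = if does (i <? j) then # i j else 0

    weight<-yes : ∀ {i j} → i Fin.< j → weight< i j ≡ # i j
    weight<-yes {i} {j} i<j = cong (λ b → if b then # i j else 0) (dec-true (i <? j) i<j)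

    weight<-no : ∀ {i j} → ¬ i Fin.< j → weight< i j ≡ 0
    weight<-no {i} {j} i≮j = cong (λ b → if b then # i j else 0) (dec-false (i <? j) i≮j)

    -- In an ascending list the diagonal terms and those with the later vertex first vanish, leaving
    -- each pair once.
    ∑-weight< : ∀ {xs} → AllPairs Fin._<_ xs → ∑ (λ i → ∑ (weight< i) xs) xs ≡ total xs
    ∑-weight< []                  = refl
    ∑-weight< {x ∷ xs} (x< ∷ xs<) = cong₂ _+_
      (cong₂ _+_ (weight<-no (Fin.<-irrefl {x = x} refl)) (∑-cong (All.map weight<-yes x<)))
      (begin
        ∑ (λ i → weight< i x + ∑ (weight< i) xs) xs
      ≡⟨ ∑-+ (λ i → weight< i x) (λ i → ∑ (weight< i) xs) xs ⟨
        ∑ (λ i → weight< i x) xs + ∑ (λ i → ∑ (weight< i) xs) xs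
      ≡⟨ cong₂ _+_ (trans (∑-cong (All.map (λ {i} x<i → weight<-no (Fin.<-asym x<i)) x<)) (∑-zero xs)) (∑-weight< xs<) ⟩
        total xs ∎)
      where open ≡-Reasoning

    size-edges : size (edges m) ≡ total (allFin m)
    size-edges = begin
        size (edges m)
      ≡⟨ ∑-filter ascending? weight (cartesianProduct (allFin m) (allFin m)) ⟩
        ∑ (λ e → weight< (proj₁ e) (proj₂ e)) (cartesianProduct (allFin m) (allFin m))
      ≡⟨ ∑-cartesianProduct (λ e → weight< (proj₁ e) (proj₂ e)) (allFin m) (allFin m) ⟩
        ∑ (λ i → ∑ (weight< i) (allFin m)) (allFin m)
      ≡⟨ ∑-weight< (tabulate⁺-< (λ i<j → i<j)) ⟩
        total (allFin m) ∎
      where open ≡-Reasoning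

    weight<-both : (∀ x y → w x y ≡ w y x) → ∀ {i j} → i ≢ j → weight< i j + weight< j i ≡ # i j
    weight<-both w-sym {i} {j} i≢j with Fin.<-cmp i j
    ... | tri< i<j _ j≮i = trans (cong₂ _+_ (weight<-yes i<j) (weight<-no j≮i)) (+-identityʳ _)
    ... | tri≈ _ i≡j _   = ⊥-elim (i≢j i≡j)
    ... | tri> i≮j _ j<i = trans (cong₂ _+_ (weight<-no i≮j) (weight<-yes j<i)) (#-sym w-sym j i)

  Matched : (Fin m → Fin m) → Fin m × Fin m → Set
  Matched μ (x , y) = μ x ≡ y × μ y ≡ x × x ≢ y

  mate : List (Fin m × Fin m) → Fin m → Fin m
  -- This default is reached only by vertices that occur in no pair; a spanning list has none.
  mate []            v = v
  mate ((a , b) ∷ L) v =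
    if does (v ≟ a) then b else if does (v ≟ b) then a else mate L v

  -- As all entries are distinct, vertices of later pairs pass the tests on `a` and `b` and keep the
  -- mate found in the tail.
  mate-matched : ∀ {L} → Unique (flatten L) → All (Matched (mate L)) L
  mate-matched {[]}          _                            = []
  mate-matched {(a , b) ∷ L} ((a≢b ∷ a≢) ∷ b≢ ∷ unique) =
    (at-a , at-b , a≢b) ∷
    All.zipWith (λ { ((a≢x , a≢y) , (b≢x , b≢y) , μx , μy , x≢y) →
                     trans (elsewhere a≢x b≢x) μx , trans (elsewhere a≢y b≢y) μy , x≢y })
      (All-flatten⁻ L a≢ , All.zip (All-flatten⁻ L b≢ , mate-matched unique))
    where
    at-a : mate ((a , b) ∷ L) a ≡ b
    at-a rewrite dec-true (a ≟ a) refl = refl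
    at-b : mate ((a , b) ∷ L) b ≡ a
    at-b rewrite dec-false (b ≟ a) (λ b≡a → a≢b (sym b≡a)) | dec-true (b ≟ b) refl = refl
    elsewhere : ∀ {v} → a ≢ v → b ≢ v → mate ((a , b) ∷ L) v ≡ mate L v
    elsewhere {v} a≢v b≢v
      rewrite dec-false (v ≟ a) (λ v≡a → a≢v (sym v≡a)) | dec-false (v ≟ b) (λ v≡b → b≢v (sym v≡b)) = refl

  module _ {L : List (Fin m × Fin m)} (spanning : flatten L ↭ allFin m) where

    matched : All (Matched (mate L)) L
    matched = mate-matched (↭ₛ.Unique-resp-↭ (setoid _) (↭⇒↭ₛ (↭-sym spanning)) (allFin⁺ m))

    everywhere : ∀ {P : Fin m → Set} → All (λ e → P (proj₁ e) × P (proj₂ e)) L → ∀ v → P v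
    everywhere ps v = All.lookup (All-flatten⁺ ps) (∈-resp-↭ (↭-sym spanning) (∈-allFin v))

    toPerfectMatching : PerfectMatching m
    toPerfectMatching = record
      { partner      = mate L
      ; involutive   = everywhere (All.map
          (λ { (μx , μy , _) → trans (cong (mate L) μx) μy , trans (cong (mate L) μy) μx }) matched)
      ; fixpointFree = everywhere (All.map
          (λ { (μx , μy , x≢y) → (λ eq → x≢y (trans (sym eq) μx)) , (λ eq → x≢y (trans (sym μy) eq)) }) matched)
      }

    -- Summing over the vertices in the order of `flatten L` puts both ends of each pair side by
    -- side, and exactly one of the two orientations is ascending.
    size-matchingEdges : ∀ w → (∀ x y → w x y ≡ w y x) →
      Coloured.size w (matchingEdges toPerfectMatching) ≡ Coloured.size w L
    size-matchingEdges w w-sym = begin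
        size (matchingEdges toPerfectMatching)
      ≡⟨ ∑-filter ascending? weight (map (λ i → i , mate L i) (allFin m)) ⟩
        ∑ (λ e → weight< w (proj₁ e) (proj₂ e)) (map (λ i → i , mate L i) (allFin m))
      ≡⟨ ∑-map _ (λ i → i , mate L i) (allFin m) ⟩
        ∑ (λ i → weight< w i (mate L i)) (allFin m)
      ≡⟨ ∑-↭ (λ i → weight< w i (mate L i)) spanning ⟨
        ∑ (λ i → weight< w i (mate L i)) (flatten L)
      ≡⟨ ∑-matched L matched ⟩
        size L ∎
      where
      open Coloured w
      open ≡-Reasoning
      ∑-matched : ∀ N → All (Matched (mate L)) N → ∑ (λ i → weight< w i (mate L i)) (flatten N) ≡ size N
      ∑-matched []            []                         = refl
      ∑-matched ((x , y) ∷ N) ((μx , μy , x≢y) ∷ rest) = trans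
        (sym (+-assoc (weight< w x (mate L x)) _ _))
        (cong₂ _+_
          (trans (cong₂ _+_ (cong (weight< w x) μx) (cong (weight< w y) μy)) (weight<-both w w-sym x≢y))
          (∑-matched N rest))

-- Sign labellings as two-colourings

isNegative : ℤ → Bool
isNegative (ℤ.+ _)    = false
isNegative -[1+ _ ] = true

module _ {m : ℕ} (σ : Fin m → Fin m → ℤ) where

  -- Extends the labelling symmetrically, reading distinct `i` and `j` in ascending order.
  negative : Fin m → Fin m → Bool
  negative i j = if does (i <? j) then isNegative (σ i j) else isNegative (σ j i)

  negative-< : ∀ {i j} → i Fin.< j → negative i j ≡ isNegative (σ i j)
  negative-< {i} {j} i<j = cong (λ b → if b then isNegative (σ i j) else isNegative (σ j i)) (dec-true (i <? j) i<j)

  negative-≮ : ∀ {i j} → ¬ i Fin.< j → negative i j ≡ isNegative (σ j i)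
  negative-≮ {i} {j} i≮j = cong (λ b → if b then isNegative (σ i j) else isNegative (σ j i)) (dec-false (i <? j) i≮j)

  negative-sym : ∀ i j → negative i j ≡ negative j i
  negative-sym i j with Fin.<-cmp i j
  ... | tri< i<j _ j≮i  = trans (negative-< i<j) (sym (negative-≮ j≮i))
  ... | tri≈ _ refl _   = refl
  ... | tri> i≮j _ j<i  = trans (negative-≮ i≮j) (sym (negative-< j<i))

  open Coloured

  sumℤ-⊖ : IsSignLabelling σ → ∀ {E} → All Ascending E →
    sumℤ (map (λ e → σ (proj₁ e) (proj₂ e)) E) ≡ size (complement negative) E ⊖ size negative E
  sumℤ-⊖ sign [] = refl
  sumℤ-⊖ sign {(i , j) ∷ E} (i<j ∷ asc) with sign i j i<j
  ... | inj₁ eq rewrite negative-< i<j | eq | sumℤ-⊖ sign asc =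
    ℤ.distribʳ-⊖-+-pos 1 (size (complement negative) E) (size negative E)
  ... | inj₂ eq rewrite negative-< i<j | eq | sumℤ-⊖ sign asc =
    ℤ.distribʳ-⊖-+-neg 0 (size (complement negative) E) (size negative E)

  σ-total-⊖ : IsSignLabelling σ →
    σ-total σ ≡ size (complement negative) (edges m) ⊖ size negative (edges m)
  σ-total-⊖ sign = sumℤ-⊖ sign (all-filter ascending? (cartesianProduct (allFin m) (allFin m)))

  σ-matching-⊖ : IsSignLabelling σ → ∀ M →
    σ-matching σ M ≡ size (complement negative) (matchingEdges M) ⊖ size negative (matchingEdges M)
  σ-matching-⊖ sign M =
    sumℤ-⊖ sign (all-filter ascending? (map (λ i → i , PerfectMatching.partner M i) (allFin m)))

⊖≡0⇒≡ : ∀ a b → a ⊖ b ≡ 0ℤ → a ≡ b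
⊖≡0⇒≡ a b eq = ℤ.+-injective (ℤ.i-j≡0⇒i≡j (ℤ.+ a) (ℤ.+ b) (trans (ℤ.m-n≡m⊖n a b) eq))

-- Deciding whether a zero-sum matching exists

anyVec? : ∀ {m k} {P : Vec (Fin m) k → Set} → Decidable P → Dec (Σ (Vec (Fin m) k) P)
anyVec? {k = zero}  P? = map′ ([] ,_) (λ { ([] , p) → p }) (P? [])
anyVec? {k = suc k} P? = map′ (λ { (x , v , p) → x ∷ v , p }) (λ { (x ∷ v , p) → x , v , p })
  (Fin.any? (λ x → anyVec? (λ v → P? (x ∷ v))))

σ-matching-cong : ∀ {m} (σ : Fin m → Fin m → ℤ) (M N : PerfectMatching m) →
  (∀ i → PerfectMatching.partner M i ≡ PerfectMatching.partner N i) → σ-matching σ M ≡ σ-matching σ N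
σ-matching-cong σ M N eq =
  cong (λ es → sumℤ (map (λ e → σ (proj₁ e) (proj₂ e)) (filter ascending? es)))
       (map-cong (λ i → cong (i ,_) (eq i)) (allFin _))

-- A partner function is given by its finite table of values, so a search through all vectors
-- suffices.
zeroMatching? : ∀ {m} (σ : Fin m → Fin m → ℤ) →
  Dec (Σ (PerfectMatching m) (λ M → σ-matching σ M ≡ 0ℤ))
zeroMatching? {m} σ = map′ from to (anyVec? table?)
  where
  open PerfectMatching
  Involution : Vec (Fin m) m → Set
  Involution v = (∀ i → lookup v (lookup v i) ≡ i) × (∀ i → lookup v i ≢ i)
  matching : ∀ v → Involution v → PerfectMatching m
  matching v (inv , free) = record { partner = lookup v ; involutive = inv ; fixpointFree = free }
  Table : Vec (Fin m) m → Set
  Table v = Σ (Involution v) (λ p → σ-matching σ (matching v p) ≡ 0ℤ)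
  table? : Decidable Table
  table? v with Fin.all? (λ i → lookup v (lookup v i) ≟ i) ×-dec Fin.all? (λ i → ¬? (lookup v i ≟ i))
  ... | no ¬p = no (λ t → ¬p (proj₁ t))
  -- `proj₂` fits whatever proof of involution the table carries, because the sum reads only
  -- `lookup v`.
  ... | yes p = map′ (p ,_) proj₂ (σ-matching σ (matching v p) ℤ.≟ 0ℤ)
  from : Σ _ Table → Σ (PerfectMatching m) (λ M → σ-matching σ M ≡ 0ℤ)
  from (v , p , eq) = matching v p , eq
  to : Σ (PerfectMatching m) (λ M → σ-matching σ M ≡ 0ℤ) → Σ _ Table
  to (M , eq) = v , p , trans (σ-matching-cong σ (matching v p) M at) eq
    where
    v = tabulate (partner M)
    at : ∀ i → lookup v i ≡ partner M i
    at = lookup∘tabulate (partner M)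
    p : Involution v
    p = (λ i → trans (at _) (trans (cong (partner M) (at i)) (involutive M i)))
      , (λ i fix → fixpointFree M i (trans (sym (at i)) fix))

theorem1 : (n : ℕ) → (σ : Fin (4 * suc n) → Fin (4 * suc n) → ℤ) →
    IsSignLabelling σ → σ-total σ ≡ 0ℤ →
    Σ (PerfectMatching (4 * suc n)) (λ M → σ-matching σ M ≡ 0ℤ)
-- The conclusion is decidable, which removes the double negation.
theorem1 n σ sign total≡0 = decidable-stable (zeroMatching? σ)
  (¬¬-map zero-sum (balanced-matching w w-sym (allFin m) (suc n) length-vs equal-totals))
  where
  m = 4 * suc n
  w = negative σ
  w-sym = negative-sym σ
  open Coloured using (size; total)
  length-vs : length (allFin m) ≡ 4 * suc n
  length-vs = length-tabulate {n = m} (λ i → i)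
  equal-totals : total w (allFin m) ≡ total (complement w) (allFin m)
  equal-totals = begin
    total w (allFin m)               ≡⟨ size-edges w ⟨
    size w (edges m)                 ≡⟨ ⊖≡0⇒≡ _ _ (trans (sym (σ-total-⊖ σ sign)) total≡0) ⟨
    size (complement w) (edges m)    ≡⟨ size-edges (complement w) ⟩
    total (complement w) (allFin m)  ∎
    where open ≡-Reasoning
  -- A spanning list has 2(n + 1) pairs, so n + 1 negative ones leave n + 1 positive ones.
  zero-sum : Σ (List (Fin m × Fin m)) (λ L → flatten L ↭ allFin m × size w L ≡ suc n) →
    Σ (PerfectMatching m) (λ M → σ-matching σ M ≡ 0ℤ)
  zero-sum (L , spanning , size≡) = M , (begin
      σ-matching σ M
    ≡⟨ σ-matching-⊖ σ sign M ⟩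
      size (complement w) (matchingEdges M) ⊖ size w (matchingEdges M)
    ≡⟨ cong₂ _⊖_ (size-matchingEdges spanning (complement w) (λ x y → cong not (w-sym x y)))
                 (size-matchingEdges spanning w w-sym) ⟩
      size (complement w) L ⊖ size w L
    ≡⟨ cong₂ _⊖_ size-complement≡ size≡ ⟩
      suc n ⊖ suc n
    ≡⟨ ℤ.n⊖n≡0 (suc n) ⟩
      0ℤ ∎)
    where
    open ≡-Reasoning
    M = toPerfectMatching spanning
    size-complement≡ : size (complement w) L ≡ suc n
    size-complement≡ = +-cancelˡ-≡ (suc n) _ _
      (trans (cong (_+ size (complement w) L) (sym size≡))
             (size-sum w w-sym (allFin m) (suc n) length-vs equal-totals L spanning))
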